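{- Let $n$ be a positive odd integer. Among all rooted binary trees on $n$ vertices, the tree $T_{r,2}^n$ minimizes the number of root containing subtrees; that is, for every rooted binary tree $T$ on $n$ vertices with root $r$, $f_T(r)\geq f_{T_{r,2}^n}(r_0)$, where $r_0$ is the root of $T_{r,2}^n$.
   Context: A rooted binary tree is a rooted tree whose root has degree $2$ and in which every other vertex has degree $1$ or $3$; the single-vertex rooted tree is also allowed. Its number of vertices is always odd. The level of a vertex is its distance to the root. $T_{r,2}^n$ denotes the rooted binary tree on $n$ vertices with exactly two vertices at every (occurring) level except level zero, which contains only the root. A subtree of a tree $T$ is a (nonempty) connected subgraph of $T$, and $f_T(v)$ denotes the number of subtrees of $T$ containing the vertex $v$. -}

module Defs where

open import Data.Fin.Base using (Fin)
open import Data.Fin.Properties using (all?; _≟_)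
open import Data.Fin.Subset using (Subset; inside; outside; _∈_; ⊤; ∣_∣; Nonempty)
open import Data.Fin.Subset.Properties using (_∈?_; nonempty?)
open import Data.List.Base as List using (List; []; _∷_; _++_)
import Data.List.Membership.Propositional as ListMembership
open import Data.List.Membership.Propositional.Properties using (∈-allFin)
open import Data.List.Relation.Unary.Any using (here; there)
open import Data.List.Relation.Unary.Linked using (Linked)
open import Data.List.Relation.Unary.Unique.Propositional using (Unique)
open import Data.Nat.Base using (ℕ; zero; suc; _≤_)
open import Data.Product.Base using (_×_; _,_; ∃; ∃-syntax; Σ-syntax)
open import Data.Sum.Base using (_⊎_; inj₁; inj₂)
open import Data.Vec.Base as Vec using (Vec)
open import Function.Bundles using (_⇔_)
open import Level using (0ℓ)
open import Relation.Binary.Core using (Rel)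
open import Relation.Binary.Construct.Closure.ReflexiveTransitive
  using (Star; ε; _◅_; _◅◅_; fold)
open import Relation.Binary.Definitions using (Decidable; Symmetric)
open import Relation.Binary.PropositionalEquality using (_≡_; _≢_; refl)
open import Relation.Nullary.Decidable using (Dec; map′; _×-dec_; _⊎-dec_; _→-dec_)
open import Relation.Nullary.Negation using (¬_)
open import Relation.Unary as Unary using ()

private
  variable
    n : ℕ

------------------------------------------------------------------------
-- Finite simple graphs

-- An edge set is stored as an adjacency matrix: row u is the set of
-- neighbours of u.
EdgeSet : ℕ → Set
EdgeSet n = Vec (Subset n) n

Adj : EdgeSet n → Rel (Fin n) 0ℓ
Adj E u v = v ∈ Vec.lookup E u

record Graph (n : ℕ) : Set where
  field
    edges       : EdgeSet n
    symmetric   : Symmetric (Adj edges)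
    irreflexive : ∀ v → ¬ Adj edges v v

  degree : Fin n → ℕ
  degree v = ∣ Vec.lookup edges v ∣

open Graph

-- An element of Star (Adj E) u v is a walk from u to v.  When the ends of
-- all edges of E lie in V, such a walk between vertices of V stays in V.
IsConnected : Subset n → EdgeSet n → Set
IsConnected V E = ∀ u v → u ∈ V → v ∈ V → Star (Adj E) u v

-- v ∷ vs lists the distinct vertices of a cycle, at least three in number;
-- the closing edge joins the last of them to v.
IsCycle : EdgeSet n → Fin n → List (Fin n) → Set
IsCycle E v vs =
  2 ≤ List.length vs × Unique (v ∷ vs) × Linked (Adj E) (v ∷ vs ++ v ∷ [])

IsTree : Graph n → Set
IsTree G = IsConnected ⊤ (edges G) × (∀ v vs → ¬ IsCycle (edges G) v vs)

------------------------------------------------------------------------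
-- Rooted binary trees

record RootedBinaryTree (n : ℕ) : Set where
  field
    graph   : Graph n
    isTree  : IsTree graph
    root    : Fin n
    degrees : n ≡ 1 ⊎
              (degree graph root ≡ 2 ×
               (∀ v → v ≢ root → degree graph v ≡ 1 ⊎ degree graph v ≡ 3))

open RootedBinaryTree

walkLength : {R : Rel (Fin n) 0ℓ} {u v : Fin n} → Star R u v → ℕ
walkLength = fold (λ _ _ → ℕ) (λ _ → suc) zero

IsDistance : EdgeSet n → Fin n → Fin n → ℕ → Set
IsDistance E u v k =
  (Σ[ p ∈ Star (Adj E) u v ] walkLength p ≡ k) ×
  ((q : Star (Adj E) u v) → k ≤ walkLength q)

HasLevel : RootedBinaryTree n → ℕ → Fin n → Set
HasLevel T k v = IsDistance (edges (graph T)) (root T) v k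

-- The property defining the tree T_{r,2}^n: every level k ≥ 1 that occurs
-- consists of exactly two vertices.
TwoPerLevel : RootedBinaryTree n → Set
TwoPerLevel {n} T =
  ∀ k → 1 ≤ k → ∃ (HasLevel T k) →
  ∃[ S ] ∣ S ∣ ≡ 2 × (∀ (v : Fin n) → v ∈ S ⇔ HasLevel T k v)

------------------------------------------------------------------------
-- Subtrees

-- The pair (V , E) is a subgraph of G with vertex set V and edge set E; E
-- need not contain all edges of G between vertices of V.
IsSubgraph : Graph n → Subset n × EdgeSet n → Set
IsSubgraph G (V , E) =
  (∀ u v → Adj E u v → Adj E v u) ×
  (∀ u v → Adj E u v → Adj (edges G) u v × u ∈ V × v ∈ V)

IsSubtree : Graph n → Subset n × EdgeSet n → Set
IsSubtree G (V , E) = IsSubgraph G (V , E) × Nonempty V × IsConnected V E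

-- Decidability of the reflexive-transitive closure on Fin n, by Warshall's
-- algorithm: Via R xs u v says that v can be reached from u with all
-- intermediate vertices in xs.
module _ (R : Rel (Fin n) 0ℓ) where

  open ListMembership using () renaming (_∈_ to _∈ₗ_)

  Via : List (Fin n) → Rel (Fin n) 0ℓ
  Via []       u v = u ≡ v ⊎ R u v
  Via (x ∷ xs) u v = Via xs u v ⊎ (Via xs u x × Via xs x v)

  via? : Decidable R → ∀ xs → Decidable (Via xs)
  via? R? []       u v = (u ≟ v) ⊎-dec R? u v
  via? R? (x ∷ xs) u v = via? R? xs u v ⊎-dec (via? R? xs u x ×-dec via? R? xs x v)

  via⇒star : ∀ xs {u v} → Via xs u v → Star R u v
  via⇒star []       (inj₁ refl)    = ε
  via⇒star []       (inj₂ r)       = r ◅ ε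
  via⇒star (x ∷ xs) (inj₁ p)       = via⇒star xs p
  via⇒star (x ∷ xs) (inj₂ (p , q)) = via⇒star xs p ◅◅ via⇒star xs q

  via-base : ∀ xs {u v} → u ≡ v ⊎ R u v → Via xs u v
  via-base []       b = b
  via-base (x ∷ xs) b = inj₁ (via-base xs b)

  via-trans : ∀ xs {u w v} → w ∈ₗ xs → Via xs u w → Via xs w v → Via xs u v
  via-trans (x ∷ xs) (here refl) (inj₁ p)       (inj₁ q)       = inj₂ (p , q)
  via-trans (x ∷ xs) (here refl) (inj₁ p)       (inj₂ (_ , q)) = inj₂ (p , q)
  via-trans (x ∷ xs) (here refl) (inj₂ (p , _)) (inj₁ q)       = inj₂ (p , q)
  via-trans (x ∷ xs) (here refl) (inj₂ (p , _)) (inj₂ (_ , q)) = inj₂ (p , q)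
  via-trans (x ∷ xs) (there w∈) (inj₁ p)       (inj₁ q)       = inj₁ (via-trans xs w∈ p q)
  via-trans (x ∷ xs) (there w∈) (inj₁ p)       (inj₂ (q , r)) = inj₂ (via-trans xs w∈ p q , r)
  via-trans (x ∷ xs) (there w∈) (inj₂ (p , q)) (inj₁ r)       = inj₂ (p , via-trans xs w∈ q r)
  via-trans (x ∷ xs) (there w∈) (inj₂ (p , _)) (inj₂ (_ , r)) = inj₂ (p , r)

  star⇒via : ∀ {u v} → Star R u v → Via (List.allFin n) u v
  star⇒via ε             = via-base (List.allFin n) (inj₁ refl)
  star⇒via (_◅_ {j = w} r p) =
    via-trans (List.allFin n) (∈-allFin w) (via-base (List.allFin n) (inj₂ r)) (star⇒via p)

  star? : Decidable R → Decidable (Star R)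
  star? R? u v =
    map′ (via⇒star (List.allFin n)) star⇒via (via? R? (List.allFin n) u v)

adj? : (E : EdgeSet n) → Decidable (Adj E)
adj? E u v = v ∈? Vec.lookup E u

isConnected? : (V : Subset n) (E : EdgeSet n) → Dec (IsConnected V E)
isConnected? V E =
  all? λ u → all? λ v → (u ∈? V) →-dec ((v ∈? V) →-dec star? (Adj E) (adj? E) u v)

isSubgraph? : (G : Graph n) → Unary.Decidable (IsSubgraph G)
isSubgraph? G (V , E) =
  (all? λ u → all? λ v → adj? E u v →-dec adj? E v u) ×-dec
  (all? λ u → all? λ v →
    adj? E u v →-dec (adj? (edges G) u v ×-dec ((u ∈? V) ×-dec (v ∈? V))))

isSubtree? : (G : Graph n) → Unary.Decidable (IsSubtree G)
isSubtree? G (V , E) =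
  isSubgraph? G (V , E) ×-dec (nonempty? V ×-dec isConnected? V E)

-- All vectors with entries from xs, each occurring once if xs is
-- repetition-free.
allVecs : {A : Set} → List A → ∀ m → List (Vec A m)
allVecs xs zero    = Vec.[] ∷ []
allVecs xs (suc m) = List.cartesianProductWith Vec._∷_ xs (allVecs xs m)

allSubsets : ∀ n → List (Subset n)
allSubsets = allVecs (outside ∷ inside ∷ [])

allEdgeSets : ∀ n → List (EdgeSet n)
allEdgeSets n = allVecs (allSubsets n) n

subtreesContaining : Graph n → Fin n → List (Subset n × EdgeSet n)
subtreesContaining {n} G v =
  List.filter (λ (V , E) → isSubtree? G (V , E) ×-dec (v ∈? V))
    (List.cartesianProduct (allSubsets n) (allEdgeSets n))

numSubtreesContaining : Graph n → Fin n → ℕ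
numSubtreesContaining G v = List.length (subtreesContaining G v)

numRootSubtrees : RootedBinaryTree n → ℕ
numRootSubtrees T = numSubtreesContaining (graph T) (root T)

{-# OPTIONS --safe #-}

-- Since a tree is acyclic, a subtree through the root is induced by its vertex
-- set, and the vertex sets that occur are those closed under taking parents.
-- Writing f(v) for the number of such sets in the branch below v, f(v) = 1 at a
-- leaf and f(v) = (1 + f(a)) (1 + f(b)) at a vertex with children a and b.  With
-- i internal vertices, n = 2 i + 1 and f + 2 ≥ 3 · 2^i, by the inequality
-- (3x − 1) (3y − 1) ≥ 2 (3xy − 1), that is 3 (x − 1) (y − 1) ≥ 0.  Equality
-- holds if at most two vertices share a level, since then one child of every
-- internal vertex is a leaf.

module Submission where

open import Defs
open import Data.Bool.Base using (if_then_else_)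
open import Data.Fin.Base using (Fin; zero; suc; combine; remQuot)
open import Data.Fin.Properties as Fin using (any?; combine-injective)
open import Data.Fin.Subset
  using (Subset; inside; outside; _∈_; _∉_; _⊆_; ⊥; ⁅_⁆; _∪_; _∩_; _-_; ∣_∣)
open import Data.Fin.Subset.Properties
open import Data.List.Base as List using (List; []; _∷_; _++_; _∷ʳ_; length)
open import Data.List.Membership.Propositional using () renaming (_∈_ to _∈ₗ_)
open import Data.List.Membership.Propositional.Properties
  using (∈-filter⁺; ∈-filter⁻; ∈-cartesianProduct⁺; ∈-cartesianProductWith⁺; ∈-lookup;
         ∈-++⁺ˡ; ∈-++⁺ʳ; ∈-++⁻)
open import Data.List.Properties using (length-++)
open import Data.List.Relation.Unary.All as All using (All; []; _∷_)
import Data.List.Relation.Unary.All.Properties as All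
open import Data.List.Relation.Unary.AllPairs using ([]; _∷_)
import Data.List.Relation.Unary.AllPairs.Properties as AllPairs
open import Data.List.Relation.Unary.Any as Any using (here; there)
open import Data.List.Relation.Unary.Any.Properties using (lookup-index)
open import Data.List.Relation.Unary.Linked using (Linked; []; [-]; _∷_)
open import Data.List.Relation.Unary.Unique.Propositional using (Unique)
import Data.List.Relation.Unary.Unique.Propositional.Properties as Unique
open import Data.Nat using (ℕ; zero; suc; _+_; _*_; _^_; _≤_; _<_; _≥_; z≤n; s≤s; _%_; _/_)
open import Data.Nat.DivMod using (m≡m%n+[m/n]*n)
open import Data.Nat.Properties as ℕ using ()
open import Data.Nat.Tactic.RingSolver using (solve-∀)
open import Data.Product using (_×_; _,_; proj₁; proj₂; ∃-syntax; ∃₂; Σ-syntax; uncurry)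
open import Data.Sum using (_⊎_; inj₁; inj₂; [_,_]′)
open import Data.Vec.Base as Vec using (Vec; []; _∷_; here; there)
open import Data.Vec.Properties
  using (∷-injective; lookup∘tabulate; tabulate∘lookup; tabulate-cong)
open import Function using (_∘_; id; _⇔_; mk⇔; Equivalence)
open import Level using (0ℓ)
open import Relation.Binary.Construct.Closure.ReflexiveTransitive as Star
  using (Star; ε; _◅_; _◅◅_)
open import Relation.Binary.Core using (Rel)
open import Relation.Binary.Definitions using (tri<; tri≈; tri>)
open import Relation.Binary.PropositionalEquality
open import Relation.Nullary using (¬_; Dec; yes; no; contradiction)
open import Relation.Nullary.Decidable using (_×-dec_)

open Graph
open RootedBinaryTree

-- Graphs are adjacency matrices and acyclicity speaks of lists of vertices, so parents and branches
-- have to be extracted first. `Ranking` is the interface: distance from the root yields one for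
-- every tree, and conversely a ranking forces connectedness and acyclicity, so a tree with two
-- vertices per level can be built from parent data alone. Counting needs no bijection: subtrees are
-- the entries of a filtered list, an injection of codes into this list bounds its length from
-- below, which serves an arbitrary tree, and an injection of the list into codes bounds it from
-- above, which serves the minimizer. The 2 in f + 2 arises because -2 is the fixed point of c -> 2
-- (1 + c), the effect of a new root with an extra leaf child: each such step doubles f + 2 exactly,
-- starting from 3 at a leaf.

private
  variable
    A : Set
    n k : ℕ

-- Sizes of finite subsets

x∈p-y⇒x≢y : ∀ {x : Fin n} {S : Subset n} {y} → x ∈ S - y → x ≢ y
x∈p-y⇒x≢y {x = zero}  {_ ∷ _} {zero}  () refl
x∈p-y⇒x≢y {x = suc x} {_ ∷ S} {suc y} x∈ refl = x∈p-y⇒x≢y {S = S} (drop-there x∈) refl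

∣p∣≡1+∣p-x∣ : ∀ {x : Fin n} {S : Subset n} → x ∈ S → ∣ S ∣ ≡ suc ∣ S - x ∣
∣p∣≡1+∣p-x∣ {S = inside ∷ S} here = cong (suc ∘ ∣_∣) (sym (p─⊥≡p S))
∣p∣≡1+∣p-x∣ {S = inside ∷ S} (there x∈S) = cong suc (∣p∣≡1+∣p-x∣ x∈S)
∣p∣≡1+∣p-x∣ {S = outside ∷ S} (there x∈S) = ∣p∣≡1+∣p-x∣ x∈S

∣p∣≡0⇒∉ : ∀ {S : Subset n} → ∣ S ∣ ≡ 0 → ∀ {x} → x ∉ S
∣p∣≡0⇒∉ ∣S∣≡0 x∈S = contradiction (trans (sym ∣S∣≡0) (∣p∣≡1+∣p-x∣ x∈S)) λ ()

∣p∣≡1+k⇒nonempty : ∀ (S : Subset n) → ∣ S ∣ ≡ suc k → ∃[ x ] x ∈ S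
∣p∣≡1+k⇒nonempty (inside ∷ S) _ = zero , here
∣p∣≡1+k⇒nonempty (outside ∷ S) ∣S∣≡ with ∣p∣≡1+k⇒nonempty S ∣S∣≡
... | x , x∈S = suc x , there x∈S

∣p∣≡2⇒pair : ∀ {S : Subset n} → ∣ S ∣ ≡ 2 →
             ∃₂ λ x y → x ≢ y × x ∈ S × y ∈ S × (∀ {z} → z ∈ S → z ≡ x ⊎ z ≡ y)
∣p∣≡2⇒pair {S = S} ∣S∣≡2
  with x , x∈S ← ∣p∣≡1+k⇒nonempty S ∣S∣≡2
  with ∣S-x∣≡1 ← ℕ.suc-injective (trans (sym (∣p∣≡1+∣p-x∣ x∈S)) ∣S∣≡2)
  with y , y∈S-x ← ∣p∣≡1+k⇒nonempty (S - x) ∣S-x∣≡1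
  with ∣S-x-y∣≡0 ← ℕ.suc-injective (trans (sym (∣p∣≡1+∣p-x∣ y∈S-x)) ∣S-x∣≡1)
  = x , y , x∈p-y⇒x≢y {S = S} y∈S-x ∘ sym , x∈S , p─q⊆p S ⁅ x ⁆ y∈S-x , only
  where
  only : ∀ {z} → z ∈ S → z ≡ x ⊎ z ≡ y
  only {z} z∈S with z Fin.≟ x | z Fin.≟ y
  ... | yes z≡x | _       = inj₁ z≡x
  ... | no  _   | yes z≡y = inj₂ z≡y
  ... | no  z≢x | no  z≢y =
    contradiction (x∈p∧x≢y⇒x∈p-y (x∈p∧x≢y⇒x∈p-y z∈S z≢x) z≢y) (∣p∣≡0⇒∉ ∣S-x-y∣≡0)

least : {P : ℕ → Set} → (∀ k → Dec (P k)) → ∀ k → P k →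
        ∃[ l ] P l × (∀ {j} → P j → l ≤ j)
least {P} P? zero    p = zero , p , λ _ → z≤n
least {P} P? (suc k) p with P? 0
... | yes p₀ = zero , p₀ , λ _ → z≤n
... | no ¬p₀ with least (P? ∘ suc) k p
...   | l , pl , min = suc l , pl , λ {j} → lower j
  where
  lower : ∀ j → P j → suc l ≤ j
  lower zero    p₀ = contradiction p₀ ¬p₀
  lower (suc j) pj = s≤s (min pj)

bounded : (f : Fin n → ℕ) → ∃[ b ] ∀ v → f v ≤ b
bounded {zero}  f = 0 , λ ()
bounded {suc n} f with bounded (f ∘ suc)
... | b , f≤b = f zero + b , λ where
  zero    → ℕ.m≤m+n _ _
  (suc v) → ℕ.≤-trans (f≤b v) (ℕ.m≤n+m _ _)

-- Counting list entries by injections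

-- The position of `f i` in `xs` determines `f i`, so positions give an injection into
-- `Fin (length xs)`.
injection⇒length≤ : ∀ {m} (xs : List A) (f : Fin m → A) → (∀ i → f i ∈ₗ xs) →
                    (∀ {i j} → f i ≡ f j → i ≡ j) → m ≤ length xs
injection⇒length≤ xs f f∈ f-injective = Fin.injective⇒≤ {f = λ i → Any.index (f∈ i)} λ {i} {j} eq →
  f-injective (trans (lookup-index (f∈ i)) (trans (cong (List.lookup xs) eq) (sym (lookup-index (f∈ j)))))

lookup-injective : ∀ {xs : List A} → Unique xs → ∀ i j → List.lookup xs i ≡ List.lookup xs j → i ≡ j
lookup-injective (_ ∷ _)   zero    zero    _  = refl
lookup-injective (x∉ ∷ _)  zero    (suc j) eq =
  contradiction eq (All.lookup x∉ (∈-lookup j))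
lookup-injective (x∉ ∷ _)  (suc i) zero    eq =
  contradiction (sym eq) (All.lookup x∉ (∈-lookup i))
lookup-injective (_ ∷ xs!) (suc i) (suc j) eq = cong suc (lookup-injective xs! i j eq)

∈-allVecs : ∀ {xs : List A} → (∀ x → x ∈ₗ xs) → ∀ {m} (v : Vec A m) → v ∈ₗ allVecs xs m
∈-allVecs ∈xs []      = here refl
∈-allVecs ∈xs (x ∷ v) = ∈-cartesianProductWith⁺ _∷_ (∈xs x) (∈-allVecs ∈xs v)

allVecs-unique : ∀ {xs : List A} → Unique xs → ∀ m → Unique (allVecs xs m)
allVecs-unique xs! zero    = [] ∷ []
allVecs-unique xs! (suc m) = Unique.cartesianProductWith⁺ _∷_ ∷-injective xs! (allVecs-unique xs! m)

∈-allSubsets : (S : Subset n) → S ∈ₗ allSubsets n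
∈-allSubsets = ∈-allVecs λ where
  outside → here refl
  inside  → there (here refl)

allSubsets-unique : ∀ n → Unique (allSubsets n)
allSubsets-unique = allVecs-unique (((λ ()) ∷ []) ∷ [] ∷ [])

-- Arithmetic of the bound

product-bound : ∀ {x y c d} → 0 < x → 0 < y → 3 * x ≤ c + 2 → 3 * y ≤ d + 2 →
                3 * (2 * (x * y)) ≤ suc c * suc d + 2
product-bound {suc p} {suc q} {c} {d} _ _ x≤ y≤ with ℕ.m≤n⇒∃[o]m+o≡n x≤ | ℕ.m≤n⇒∃[o]m+o≡n y≤
... | s , c≡ | t , d≡ = subst₂ (λ c d → 3 * (2 * (suc p * suc q)) ≤ suc c * suc d + 2)
    (ℕ.+-cancelʳ-≡ 2 (suc (3 * p + s)) c (trans (sym (excess p s)) c≡))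
    (ℕ.+-cancelʳ-≡ 2 (suc (3 * q + t)) d (trans (sym (excess q t)) d≡))
    (subst (3 * (2 * (suc p * suc q)) ≤_) (expand p q s t) (ℕ.m≤m+n _ _))
  where
  excess : ∀ p s → 3 * suc p + s ≡ suc (3 * p + s) + 2
  excess = solve-∀
  -- With x = p + 1 and y = q + 1, the bracket is the slack of the inequality: `3 * p * q` is 3 (x -
  -- 1) (y - 1), and the remaining terms come from the slacks `s` and `t` of the two hypotheses. All
  -- are nonnegative.
  expand : ∀ p q s t → 3 * (2 * (suc p * suc q)) + (3 * p * q + (2 + 3 * p) * t + (2 + 3 * q) * s + s * t) ≡
                       suc (suc (3 * p + s)) * suc (suc (3 * q + t)) + 2
  expand = solve-∀

double : ∀ c i → c + 2 ≡ 3 * 2 ^ i → 2 * suc c + 2 ≡ 3 * 2 ^ suc i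
double c i eq = trans (left c) (trans (cong (2 *_) eq) (right (2 ^ i)))
  where
  left : ∀ c → 2 * suc c + 2 ≡ 2 * (c + 2)
  left = solve-∀
  right : ∀ x → 2 * (3 * x) ≡ 3 * (2 * x)
  right = solve-∀

linked-∷ʳ : ∀ {R : Rel A 0ℓ} xs {y z} → Linked R (xs ∷ʳ y) → R y z → Linked R (xs ∷ʳ y ∷ʳ z)
linked-∷ʳ []           _          ryz = ryz ∷ [-]
linked-∷ʳ (x ∷ [])     (rxy ∷ l)  ryz = rxy ∷ linked-∷ʳ [] l ryz
linked-∷ʳ (x ∷ w ∷ xs) (rxw ∷ l)  ryz = rxw ∷ linked-∷ʳ (w ∷ xs) l ryz

-- From a tree to a ranking

-- The rooted structure of a tree, given by the distance from the root; the
-- edges are then exactly the pairs of a vertex and its parent.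
record Ranking (G : Graph n) (r : Fin n) : Set where
  field
    rank : Fin n → ℕ

  Child : Fin n → Fin n → Set
  Child u v = Adj (edges G) u v × rank v ≡ suc (rank u)

  field
    rank-root     : rank r ≡ 0
    adj⇒child     : ∀ {u v} → Adj (edges G) u v → Child u v ⊎ Child v u
    parent        : ∀ v → v ≢ r → ∃[ u ] Child u v
    parent-unique : ∀ {u u′ v} → Child u v → Child u′ v → u ≡ u′

module TreeRanking (G : Graph n) (r : Fin n) (G-tree : IsTree G) where

  private
    E = edges G

  -- Fixing the length makes existence decidable, as the search by `least` requires; exposing the
  -- last edge lets a shortest walk hand over the parent of its end.
  Walk : ℕ → Fin n → Set
  Walk zero    v = r ≡ v
  Walk (suc k) v = ∃[ u ] Walk k u × Adj E u v

  walk? : ∀ k v → Dec (Walk k v)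
  walk? zero    v = r Fin.≟ v
  walk? (suc k) v = any? λ u → walk? k u ×-dec adj? E u v

  extend : ∀ {u v} → Star (Adj E) u v → ∃[ k ] Walk k u → ∃[ k ] Walk k v
  extend ε       w       = w
  extend (e ◅ p) (k , w) = extend p (suc k , _ , w , e)

  shortest : ∀ v → ∃[ k ] Walk k v × (∀ {j} → Walk j v → k ≤ j)
  shortest v = uncurry (least (λ k → walk? k v)) (extend (proj₁ G-tree r v ∈⊤ ∈⊤) (0 , refl))

  dist : Fin n → ℕ
  dist v = proj₁ (shortest v)

  dist-minimal : ∀ {v j} → Walk j v → dist v ≤ j
  dist-minimal {v} = proj₂ (proj₂ (shortest v))

  dist≤1+dist : ∀ {u v} → Adj E u v → dist v ≤ suc (dist u)
  dist≤1+dist {u} e = dist-minimal (u , proj₁ (proj₂ (shortest u)) , e)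

  -- A shortest walk without its last edge is again shortest: it has length `k`, and anything
  -- shorter would bring `v` closer too.
  predecessor : ∀ {v k} → dist v ≡ suc k → ∃[ u ] Adj E u v × dist u ≡ k
  predecessor {v} {k} dv≡ with subst (λ j → Walk j v) dv≡ (proj₁ (proj₂ (shortest v)))
  ... | u , w , e =
    u , e , ℕ.≤-antisym (dist-minimal w) (ℕ.≤-pred (subst (_≤ suc (dist u)) dv≡ (dist≤1+dist e)))

  unique-ends : ∀ {u v xs} → u ≢ v → dist u ≡ k → dist v ≡ k →
                All (λ x → dist x < k) xs → Unique xs → Unique (u ∷ xs ∷ʳ v)
  unique-ends {k} {u} {v} {xs} u≢v du dv below xs! =
    All.++⁺ (All.map (apart du) below) (u≢v ∷ []) ∷
    AllPairs.++⁺ xs! ([] ∷ []) (All.map (λ b → (apart dv b ∘ sym) ∷ []) below)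
    where
    apart : ∀ {w x} → dist w ≡ k → dist x < k → w ≢ x
    apart dw dx refl = ℕ.<-irrefl dw dx

  -- Two vertices at the same distance are joined by the path that climbs from
  -- both of them in parallel until the ancestors coincide.
  detour : ∀ k {u v} → u ≢ v → dist u ≡ k → dist v ≡ k →
           ∃[ xs ] Linked (Adj E) (u ∷ xs ∷ʳ v) × Unique xs ×
                   All (λ x → dist x < k) xs × 1 ≤ length xs
  detour zero u≢v du dv = contradiction (trans (sym (at-root du)) (at-root dv)) u≢v
    where
    at-root : ∀ {v} → dist v ≡ 0 → r ≡ v
    at-root {v} dv≡0 = subst (λ j → Walk j v) dv≡0 (proj₁ (proj₂ (shortest v)))
  detour (suc k) u≢v du dv with predecessor du | predecessor dv
  ... | p , pu , dp | q , qv , dq with p Fin.≟ q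
  ...   | yes refl =
          p ∷ [] , symmetric G pu ∷ qv ∷ [-] , [] ∷ [] , ℕ.≤-reflexive (cong suc dp) ∷ [] , s≤s z≤n
  ...   | no p≢q with detour k p≢q dp dq
  ...     | xs , linked , xs! , below , _ =
          p ∷ xs ∷ʳ q ,
          symmetric G pu ∷ linked-∷ʳ (p ∷ xs) linked qv ,
          unique-ends p≢q dp dq below xs! ,
          ℕ.≤-reflexive (cong suc dp) ∷
            All.++⁺ (All.map ℕ.m<n⇒m<1+n below) (ℕ.≤-reflexive (cong suc dq) ∷ []) ,
          s≤s z≤n

  2≤length-∷ʳ : ∀ (xs : List (Fin n)) v → 1 ≤ length xs → 2 ≤ length (xs ∷ʳ v)
  2≤length-∷ʳ (_ ∷ [])    v _ = s≤s (s≤s z≤n)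
  2≤length-∷ʳ (_ ∷ _ ∷ _) v _ = s≤s (s≤s z≤n)

  -- An edge within a level would close the detour between its ends to a cycle.
  adj⇒dist≢ : ∀ {u v} → Adj E u v → dist u ≢ dist v
  adj⇒dist≢ {u} {v} e du≡dv = proj₂ G-tree u (xs ∷ʳ v)
    (2≤length-∷ʳ xs v 1≤ , unique-ends u≢v du≡dv refl below xs! , linked-∷ʳ (u ∷ xs) linked (symmetric G e))
    where
    u≢v : u ≢ v
    u≢v refl = irreflexive G u e
    path = detour (dist v) u≢v du≡dv refl
    xs = proj₁ path
    linked = proj₁ (proj₂ path)
    xs! = proj₁ (proj₂ (proj₂ path))
    below = proj₁ (proj₂ (proj₂ (proj₂ path)))
    1≤ = proj₂ (proj₂ (proj₂ (proj₂ path)))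

  -- The detour between two parents stays at their distance or nearer to the root, so it avoids `v`,
  -- and going through `v` closes it to a cycle.
  predecessor-unique : ∀ {u u′ v} → Adj E u v → dist v ≡ suc (dist u) →
                       Adj E u′ v → dist v ≡ suc (dist u′) → u ≡ u′
  predecessor-unique {u} {u′} {v} e dv e′ dv′ with u Fin.≟ u′
  ... | yes u≡u′ = u≡u′
  ... | no u≢u′ with detour (dist u) u≢u′ refl (ℕ.suc-injective (trans (sym dv′) dv))
  ...   | xs , linked , xs! , below , 1≤ = contradiction
          (s≤s (ℕ.≤-trans (s≤s z≤n) (2≤length-∷ʳ xs u′ 1≤)) ,
           (above e dv ∷ All.++⁺ (All.map (λ { b refl → ℕ.<-asym b (ℕ.≤-reflexive (sym dv)) }) below)
                                 (above e′ dv′ ∷ [])) ∷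
             unique-ends u≢u′ refl (ℕ.suc-injective (trans (sym dv′) dv)) below xs! ,
           symmetric G e ∷ linked-∷ʳ (u ∷ xs) linked e′)
          (proj₂ G-tree v (u ∷ xs ∷ʳ u′))
    where
    above : ∀ {w} → Adj E w v → dist v ≡ suc (dist w) → v ≢ w
    above e _ refl = irreflexive G v e

  ranking : Ranking G r
  ranking = record
    { rank          = dist
    ; rank-root     = ℕ.n≤0⇒n≡0 (dist-minimal refl)
    ; adj⇒child     = child
    ; parent        = λ v v≢r → parent v v≢r refl
    ; parent-unique = λ (e , d) (e′ , d′) → predecessor-unique e d e′ d′
    }
    where
    child : ∀ {u v} → Adj E u v →
            (Adj E u v × dist v ≡ suc (dist u)) ⊎ (Adj E v u × dist u ≡ suc (dist v))
    child {u} {v} e with ℕ.<-cmp (dist u) (dist v)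
    ... | tri< du<dv _ _ = inj₁ (e , ℕ.≤-antisym (dist≤1+dist e) du<dv)
    ... | tri≈ _ du≡dv _ = contradiction du≡dv (adj⇒dist≢ e)
    ... | tri> _ _ dv<du = inj₂ (symmetric G e , ℕ.≤-antisym (dist≤1+dist (symmetric G e)) dv<du)

    parent : ∀ v → v ≢ r → ∀ {k} → dist v ≡ k → ∃[ u ] Adj E u v × dist v ≡ suc (dist u)
    parent v v≢r {zero}  dv =
      contradiction (sym (subst (λ j → Walk j v) dv (proj₁ (proj₂ (shortest v))))) v≢r
    parent v v≢r {suc k} dv with predecessor dv
    ... | u , e , du = u , e , trans dv (cong suc (sym du))

-- Graphs with a ranking are trees

data NoBacktrack {A : Set} : List A → Set where
  [-]   : ∀ {x} → NoBacktrack (x ∷ [])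
  [-,-] : ∀ {x y} → NoBacktrack (x ∷ y ∷ [])
  _∷_   : ∀ {x y z xs} → x ≢ z → NoBacktrack (y ∷ z ∷ xs) → NoBacktrack (x ∷ y ∷ z ∷ xs)

-- Read as a closed walk, a cycle repeats its base point, so it is not `Unique`. That no step is
-- undone at once survives the closing, and it passes to suffixes, as the inductions `down` and `up`
-- require.
unique⇒noBacktrack : ∀ {v : A} xs → Unique xs → All (v ≢_) xs → NoBacktrack (xs ∷ʳ v)
unique⇒noBacktrack []               _                  _              = [-]
unique⇒noBacktrack (_ ∷ [])         _                  _              = [-,-]
unique⇒noBacktrack (_ ∷ _ ∷ [])     _                  (v≢ ∷ _)       = (v≢ ∘ sym) ∷ [-,-]
unique⇒noBacktrack (_ ∷ y ∷ z ∷ xs) ((_ ∷ x≢z ∷ _) ∷ u) (_ ∷ v∉)       =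
  x≢z ∷ unique⇒noBacktrack (y ∷ z ∷ xs) u v∉

data LastStep {A : Set} (z w : A) : List A → Set where
  here  : LastStep z w (z ∷ w ∷ [])
  there : ∀ {x xs} → LastStep z w xs → LastStep z w (x ∷ xs)

lastStep-∷ʳ : ∀ (x : A) xs {w} → ∃[ z ] z ∈ₗ x ∷ xs × LastStep z w (x ∷ xs ∷ʳ w)
lastStep-∷ʳ x []       = x , here refl , here
lastStep-∷ʳ x (y ∷ xs) with lastStep-∷ʳ y xs
... | z , z∈ , last = z , there z∈ , there last

module Ranked {G : Graph n} {r : Fin n} (R : Ranking G r) where

  open Ranking R public

  private
    E = edges G

  child⇒≢ : ∀ {u v} → Child u v → u ≢ v
  child⇒≢ (_ , rv) refl = ℕ.1+n≢n (sym rv)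

  child⇒rank< : ∀ {u v} → Child u v → rank u < rank v
  child⇒rank< (_ , rv) = ℕ.≤-reflexive (sym rv)

  root-orphan : ∀ {u} → ¬ Child u r
  root-orphan (_ , rr) = contradiction (trans (sym rank-root) rr) λ ()

  root-ancestor : ∀ v → Star Child r v
  root-ancestor v = go (rank v) v refl
    where
    go : ∀ k v → rank v ≡ k → Star Child r v
    go k v rv with v Fin.≟ r
    go k       v rv | yes refl = ε
    go k       v rv | no v≢r with parent v v≢r
    go zero    v rv | no v≢r | u , _ , rv′ = contradiction (trans (sym rv) rv′) λ ()
    go (suc k) v rv | no v≢r | u , c@(_ , rv′) =
      go k u (ℕ.suc-injective (trans (sym rv′) rv)) ◅◅ (c ◅ ε)

  descend : ∀ {u v} → Star Child u v → Σ[ p ∈ Star (Adj E) u v ] rank v ≡ walkLength {R = Adj E} p + rank u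
  descend ε       = ε , refl
  descend (c ◅ p) with descend p
  ... | q , rv = proj₁ c ◅ q , trans rv (trans (cong (walkLength {R = Adj E} q +_) (proj₂ c)) (ℕ.+-suc _ _))

  adj⇒rank≤ : ∀ {u v} → Adj E u v → rank v ≤ suc (rank u)
  adj⇒rank≤ e with adj⇒child e
  ... | inj₁ (_ , rv) = ℕ.≤-reflexive rv
  ... | inj₂ (_ , ru) = ℕ.≤-trans (ℕ.n≤1+n _) (ℕ.≤-trans (ℕ.≤-reflexive (sym ru)) (ℕ.n≤1+n _))

  rank≤walk : ∀ {u v} (p : Star (Adj E) u v) → rank v ≤ walkLength {R = Adj E} p + rank u
  rank≤walk ε = ℕ.≤-refl
  rank≤walk (e ◅ p) = ℕ.≤-trans (rank≤walk p)
    (ℕ.≤-trans (ℕ.+-monoʳ-≤ (walkLength {R = Adj E} p) (adj⇒rank≤ e)) (ℕ.≤-reflexive (ℕ.+-suc _ _)))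

  -- The path of descendants from the root has length `rank v`, and no walk is shorter because an
  -- edge raises the rank by at most one. This translates levels, defined through walks, into ranks.
  isDistance⇔rank : ∀ {k v} → IsDistance E r v k ⇔ rank v ≡ k
  isDistance⇔rank {k} {v} = mk⇔ to from
    where
    drop-root : ∀ m → m + rank r ≡ m
    drop-root m = trans (cong (m +_) rank-root) (ℕ.+-identityʳ m)

    shortest : Σ[ p ∈ Star (Adj E) r v ] rank v ≡ walkLength {R = Adj E} p
    shortest with descend (root-ancestor v)
    ... | p , rv = p , trans rv (drop-root _)

    lower : (q : Star (Adj E) r v) → rank v ≤ walkLength {R = Adj E} q
    lower q = ℕ.≤-trans (rank≤walk q) (ℕ.≤-reflexive (drop-root _))

    to : IsDistance E r v k → rank v ≡ k
    to ((p , len) , min) = ℕ.≤-antisym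
      (subst (rank v ≤_) len (lower p))
      (ℕ.≤-trans (min (proj₁ shortest)) (ℕ.≤-reflexive (sym (proj₂ shortest))))

    from : rank v ≡ k → IsDistance E r v k
    from refl = (proj₁ shortest , sym (proj₂ shortest)) , lower

  -- Having come down from `x` to `y`, a step upwards could only return to the unique parent `x`,
  -- which is a backtrack.
  down : ∀ {x y ys z w} → Linked (Adj E) (x ∷ y ∷ ys) → NoBacktrack (x ∷ y ∷ ys) → Child x y →
         LastStep z w (x ∷ y ∷ ys) → Child z w × rank x < rank w
  down _ _ c here = c , child⇒rank< c
  down {ys = []} _ _ c (there (there ()))
  down {ys = _ ∷ _} (_ ∷ e ∷ l) (x≢ ∷ nb) c (there last) with adj⇒child e
  ... | inj₂ c′ = contradiction (parent-unique c c′) x≢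
  ... | inj₁ c′ with down (e ∷ l) nb c′ last
  ...   | czw , y<w = czw , ℕ.<-trans (child⇒rank< c) y<w

  -- Either some step turns downwards and `down` takes over, or the rank falls all the way.
  up : ∀ {x y ys z w} → Linked (Adj E) (x ∷ y ∷ ys) → NoBacktrack (x ∷ y ∷ ys) → Child y x →
       LastStep z w (x ∷ y ∷ ys) → Child z w ⊎ rank w < rank x
  up _ _ c here = inj₂ (child⇒rank< c)
  up {ys = []} _ _ c (there (there ()))
  up {ys = _ ∷ _} (_ ∷ e ∷ l) (_ ∷ nb) c (there last) with adj⇒child e
  ... | inj₁ c′ = inj₁ (proj₁ (down (e ∷ l) nb c′ last))
  ... | inj₂ c′ with up (e ∷ l) nb c′ last
  ...   | inj₁ czw = inj₁ czw
  ...   | inj₂ w<y = inj₂ (ℕ.<-trans w<y (child⇒rank< c))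

  -- A walk without backtracking that has started to descend keeps descending.
  -- So a cycle must leave its base point upwards and return to it from above,
  -- through the same vertex.
  acyclic : ∀ v vs → ¬ IsCycle E v vs
  acyclic v []      (() , _)
  acyclic v (_ ∷ []) (s≤s () , _)
  acyclic v (a ∷ b ∷ vs) (_ , v∉@(_ ∷ v≢b ∷ _) ∷ u@(a∉ ∷ _) , l@(e ∷ _))
    with lastStep-∷ʳ b vs {v}
  ... | z , z∈ , last with adj⇒child e
  ...   | inj₁ c = ℕ.<-irrefl refl (proj₂ (down l nb c (there (there last))))
    where nb = v≢b ∷ unique⇒noBacktrack (a ∷ b ∷ vs) u v∉
  ...   | inj₂ c with up l (v≢b ∷ unique⇒noBacktrack (a ∷ b ∷ vs) u v∉) c (there (there last))
  ...     | inj₁ c′ = All.lookup a∉ z∈ (parent-unique c c′)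
  ...     | inj₂ v<v = ℕ.<-irrefl refl v<v

  ranked⇒tree : IsTree G
  ranked⇒tree = (λ u v _ _ → Star.reverse (symmetric G) (proj₁ (descend (root-ancestor u))) ◅◅
                        proj₁ (descend (root-ancestor v))) ,
           acyclic

  -- Ancestors and descendants

  to-parent : ∀ {a x y} → Star Child a x → Child y x → a ≡ x ⊎ Star Child a y
  to-parent ε       _ = inj₁ refl
  to-parent (c ◅ p) d with to-parent p d
  ... | inj₂ q    = inj₂ (c ◅ q)
  ... | inj₁ refl with parent-unique c d
  ...   | refl = inj₂ ε

  -- Parents are unique, so the ancestors of `x` form a chain; the induction moves `b` upwards along
  -- its path one parent at a time.
  ancestors-comparable : ∀ {a b x} → Star Child a x → Star Child b x → Star Child a b ⊎ Star Child b a
  ancestors-comparable p ε       = inj₁ p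
  ancestors-comparable p (c ◅ q) with ancestors-comparable p q
  ... | inj₂ j→a = inj₂ (c ◅ j→a)
  ... | inj₁ a→j with to-parent a→j c
  ...   | inj₁ refl = inj₂ (c ◅ ε)
  ...   | inj₂ a→b  = inj₁ a→b

  star⇒rank≤ : ∀ {a x} → Star Child a x → rank a ≤ rank x
  star⇒rank≤ ε       = ℕ.≤-refl
  star⇒rank≤ (c ◅ p) = ℕ.≤-trans (ℕ.<⇒≤ (child⇒rank< c)) (star⇒rank≤ p)

  star-irreflexive : ∀ {v a x} → Child v a → Star Child a x → x ≢ v
  star-irreflexive c p refl = ℕ.<-irrefl refl (ℕ.<-≤-trans (child⇒rank< c) (star⇒rank≤ p))

  -- A common descendant would make the siblings comparable, but a proper descendant has larger rank
  -- and siblings have equal rank.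
  siblings-disjoint : ∀ {v a b x} → Child v a → Child v b → Star Child a x → Star Child b x → a ≡ b
  siblings-disjoint va vb p q with ancestors-comparable p q
  ... | inj₁ ε        = refl
  ... | inj₂ ε        = refl
  ... | inj₁ (c ◅ p′) = contradiction (trans (proj₂ va) (sym (proj₂ vb)))
                          (ℕ.<⇒≢ (ℕ.<-≤-trans (child⇒rank< c) (star⇒rank≤ p′)))
  ... | inj₂ (c ◅ p′) = contradiction (trans (proj₂ vb) (sym (proj₂ va)))
                          (ℕ.<⇒≢ (ℕ.<-≤-trans (child⇒rank< c) (star⇒rank≤ p′)))

  -- Root subtrees as sets closed under parents

  induced : Subset n → EdgeSet n
  -- Rows outside `V` are empty, so the edge set of a root subtree equals `induced V` as a vector,
  -- and counting pairs reduces to counting vertex sets.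
  induced V = Vec.tabulate λ u → if Dec.does (u ∈? V) then V ∩ Vec.lookup E u else ⊥

  induced⁺ : ∀ {V u v} → u ∈ V → v ∈ V → Adj E u v → Adj (induced V) u v
  induced⁺ {V} {u} u∈V v∈V e
    rewrite lookup∘tabulate (λ u → if Dec.does (u ∈? V) then V ∩ Vec.lookup E u else ⊥) u
    with u ∈? V
  ... | yes _   = x∈p∩q⁺ (v∈V , e)
  ... | no  u∉V = contradiction u∈V u∉V

  induced⁻ : ∀ {V u v} → Adj (induced V) u v → Adj E u v × u ∈ V × v ∈ V
  induced⁻ {V} {u} e
    rewrite lookup∘tabulate (λ u → if Dec.does (u ∈? V) then V ∩ Vec.lookup E u else ⊥) u
    with u ∈? V
  ... | yes u∈V = proj₂ (x∈p∩q⁻ V _ e) , u∈V , proj₁ (x∈p∩q⁻ V _ e)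
  ... | no  _   = contradiction e ∉⊥

  Closed : Subset n → Set
  Closed V = ∀ {u v} → Child u v → v ∈ V → u ∈ V

  closed-star : ∀ {V u v} → Closed V → Star Child u v → v ∈ V → u ∈ V
  closed-star cl ε       v∈V = v∈V
  closed-star cl (c ◅ p) v∈V = cl c (closed-star cl p v∈V)

  -- Any two vertices of `V` are connected through the root: closure keeps both ancestral paths
  -- inside `V`.
  closed⇒subtree : ∀ {V} → Closed V → r ∈ V → IsSubtree G (V , induced V)
  closed⇒subtree {V} cl r∈V =
    ((λ _ _ → flip) , (λ _ _ → induced⁻)) ,
    (r , r∈V) ,
    λ u v u∈V v∈V → Star.reverse flip (within (root-ancestor u) u∈V) ◅◅ within (root-ancestor v) v∈V
    where
    flip : ∀ {u v} → Adj (induced V) u v → Adj (induced V) v u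
    flip e with induced⁻ e
    ... | e′ , u∈V , v∈V = induced⁺ v∈V u∈V (symmetric G e′)

    within : ∀ {u v} → Star Child u v → v ∈ V → Star (Adj (induced V)) u v
    within ε       _   = ε
    within (c ◅ p) v∈V = induced⁺ (cl c j∈V) j∈V (proj₁ c) ◅ within p v∈V
      where j∈V = closed-star cl p v∈V

  -- A walk from the root can enter the branch below a vertex only through the
  -- edge from its parent, so the walks in F see all ancestral edges.
  data Supported (F : EdgeSet n) : Fin n → Set where
    base : Supported F r
    step : ∀ {u v} → Supported F u → Child u v → Adj F u v → Supported F v

  -- `Supported` behaves like a stack of edges: a step down pushes its edge, a step up pops the last
  -- one, the two matching because parents are unique.
  walk⇒supported : ∀ V F {u v} → IsSubgraph G (V , F) → Star (Adj F) u v → Supported F u → Supported F v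
  walk⇒supported V F sub ε       s = s
  walk⇒supported V F sub (e ◅ p) s with adj⇒child (proj₁ (proj₂ sub _ _ e))
  ... | inj₁ c = walk⇒supported V F sub p (step s c e)
  walk⇒supported V F sub (e ◅ p) base          | inj₂ c = contradiction c root-orphan
  walk⇒supported V F sub (e ◅ p) (step s c′ _) | inj₂ c with parent-unique c c′
  ... | refl = walk⇒supported V F sub p s

  parent-edge : ∀ V F {u v} → IsSubtree G (V , F) → r ∈ V → Child u v → v ∈ V → Adj F u v
  parent-edge V F {v = v} (sub , _ , conn) r∈V c v∈V with walk⇒supported V F sub (conn r v r∈V v∈V) base
  ... | base         = contradiction c root-orphan
  ... | step _ c′ e with parent-unique c c′
  ...   | refl = e

  subtree⇒closed : ∀ V F → IsSubtree G (V , F) → r ∈ V → Closed V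
  subtree⇒closed V F st@(sub , _) r∈V c v∈V =
    proj₁ (proj₂ (proj₂ sub _ _ (parent-edge V F st r∈V c v∈V)))

  -- Every edge of `G` inside `V` joins a vertex to its parent, and connectedness already puts such
  -- edges into `F`.
  subtree⇒induced : ∀ V F → IsSubtree G (V , F) → r ∈ V → F ≡ induced V
  subtree⇒induced V F st@(sub , _) r∈V =
    trans (sym (tabulate∘lookup F)) (trans (tabulate-cong row) (tabulate∘lookup (induced V)))
    where
    forth : ∀ {u v} → Adj F u v → Adj (induced V) u v
    forth e with proj₂ sub _ _ e
    ... | e′ , u∈V , v∈V = induced⁺ u∈V v∈V e′

    back : ∀ {u v} → Adj (induced V) u v → Adj F u v
    back e with induced⁻ e
    ... | e′ , u∈V , v∈V with adj⇒child e′
    ...   | inj₁ c = parent-edge V F st r∈V c v∈V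
    ...   | inj₂ c = proj₁ sub _ _ (parent-edge V F st r∈V c u∈V)

    row : ∀ u → Vec.lookup F u ≡ Vec.lookup (induced V) u
    row u = ⊆-antisym forth back

  -- Branches and their vertices

  Childless : Fin n → Set
  Childless v = ∀ {c} → ¬ Child v c

  TwoChildren : Fin n → Set
  TwoChildren v = ∃₂ λ a b → a ≢ b × Child v a × Child v b × (∀ {c} → Child v c → c ≡ a ⊎ c ≡ b)

  data Branch (v : Fin n) : Set where
    leaf : Childless v → Branch v
    node : ∀ {a b} → a ≢ b → Child v a → Child v b → (∀ {c} → Child v c → c ≡ a ⊎ c ≡ b) →
           Branch a → Branch b → Branch v

  count internals : ∀ {v} → Branch v → ℕ
  count (leaf _)           = 1
  count (node _ _ _ _ s t) = suc (count s) * suc (count t)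
  internals (leaf _)           = 0
  internals (node _ _ _ _ s t) = suc (internals s + internals t)

  labels : ∀ {v} → Branch v → List (Fin n)
  labels {v} (leaf _)           = v ∷ []
  labels {v} (node _ _ _ _ s t) = v ∷ labels s ++ labels t

  length-labels : ∀ {v} (t : Branch v) → length (labels t) ≡ suc (internals t * 2)
  length-labels (leaf _) = refl
  length-labels (node _ _ _ _ s t) = cong suc (trans (length-++ (labels s))
    (trans (cong₂ _+_ (length-labels s) (length-labels t)) (arith (internals s) (internals t))))
    where
    arith : ∀ x y → suc (x * 2) + suc (y * 2) ≡ suc (x + y) * 2
    arith = solve-∀

  labels⁻ : ∀ {v x} (t : Branch v) → x ∈ₗ labels t → Star Child v x
  labels⁻ (leaf _)               (here refl) = ε
  labels⁻ (node _ _ _ _ _ _)     (here refl) = ε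
  labels⁻ (node _ va vb _ s t)   (there x∈) with ∈-++⁻ (labels s) x∈
  ... | inj₁ x∈s = va ◅ labels⁻ s x∈s
  ... | inj₂ x∈t = vb ◅ labels⁻ t x∈t

  labels⁺ : ∀ {v x} (t : Branch v) → Star Child v x → x ∈ₗ labels t
  labels⁺ (leaf _)           ε       = here refl
  labels⁺ (leaf childless)   (c ◅ _) = contradiction c childless
  labels⁺ (node _ _ _ _ _ _) ε       = here refl
  labels⁺ (node _ _ _ only s t) (c ◅ p) with only c
  ... | inj₁ refl = there (∈-++⁺ˡ (labels⁺ s p))
  ... | inj₂ refl = there (∈-++⁺ʳ (labels s) (labels⁺ t p))

  labels-unique : ∀ {v} (t : Branch v) → Unique (labels t)
  labels-unique (leaf _) = [] ∷ []
  labels-unique (node a≢b va vb _ s t) =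
    All.++⁺ (All.tabulate λ x∈ → star-irreflexive va (labels⁻ s x∈) ∘ sym)
            (All.tabulate λ x∈ → star-irreflexive vb (labels⁻ t x∈) ∘ sym) ∷
    Unique.++⁺ (labels-unique s) (labels-unique t)
      λ (x∈s , x∈t) → a≢b (siblings-disjoint va vb (labels⁻ s x∈s) (labels⁻ t x∈t))

  -- `labels t` meets every vertex, the root being an ancestor of all, and repeats none, so its
  -- length is `n`. Hence trees of equal order have equally many internal vertices.
  size : (t : Branch r) → n ≡ suc (internals t * 2)
  size t = trans (ℕ.≤-antisym
    (injection⇒length≤ (labels t) id (λ x → labels⁺ t (root-ancestor x)) id)
    (Fin.injective⇒≤ λ {i} {j} → lookup-injective (labels-unique t) i j)) (length-labels t)

  -- Numbering the closed sets

  -- code numbers the closed sets containing v, restricted to the branch below v;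
  -- code? admits in addition the empty restriction, numbered zero.
  mutual
    code : ∀ {v} (t : Branch v) → Subset n → Fin (count t)
    code (leaf _)           V = zero
    code (node _ _ _ _ s t) V = combine (code? s V) (code? t V)

    code? : ∀ {v} (t : Branch v) → Subset n → Fin (suc (count t))
    code? {v} t V with v ∈? V
    ... | yes _ = suc (code t V)
    ... | no  _ = zero

  mutual
    -- The path from `v` to `x` carries the induction: closure puts each of its vertices below `v`
    -- into `V`, and equal codes then put it into `W`.
    code-⊆ : ∀ {v x V W} (t : Branch v) → Closed V → v ∈ W → code t V ≡ code t W →
             Star Child v x → x ∈ V → x ∈ W
    code-⊆ _                     cl v∈W eq ε       _   = v∈W
    code-⊆ (leaf childless)      cl v∈W eq (c ◅ _) _   = contradiction c childless
    code-⊆ {V = V} {W} (node _ _ _ only s t) cl v∈W eq (c ◅ p) x∈V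
      with combine-injective (code? s V) (code? t V) (code? s W) (code? t W) eq | only c
    ... | eq-s , _ | inj₁ refl = code?-⊆ s cl eq-s p x∈V
    ... | _ , eq-t | inj₂ refl = code?-⊆ t cl eq-t p x∈V

    code?-⊆ : ∀ {v x V W} (t : Branch v) → Closed V → code? t V ≡ code? t W →
              Star Child v x → x ∈ V → x ∈ W
    code?-⊆ {v} {V = V} {W} t cl eq p x∈V with v ∈? V | v ∈? W
    ... | yes _   | yes v∈W = code-⊆ t cl v∈W (Fin.suc-injective eq) p x∈V
    ... | no  v∉V | _       = contradiction (closed-star cl p x∈V) v∉V

  code-injective : ∀ {V W} (t : Branch r) → Closed V → Closed W → r ∈ V → r ∈ W →
                   code t V ≡ code t W → V ≡ W
  code-injective t V-cl W-cl r∈V r∈W eq = ⊆-antisym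
    (code-⊆ t V-cl r∈W eq (root-ancestor _))
    (code-⊆ t W-cl r∈V (sym eq) (root-ancestor _))

  left : ∀ {a b} (s : Branch a) (t : Branch b) → Fin (suc (count s) * suc (count t)) → Fin (suc (count s))
  left s t i = proj₁ (remQuot {suc (count s)} (suc (count t)) i)

  right : ∀ {a b} (s : Branch a) (t : Branch b) → Fin (suc (count s) * suc (count t)) → Fin (suc (count t))
  right s t i = proj₂ (remQuot {suc (count s)} (suc (count t)) i)

  mutual
    decode : ∀ {v} (t : Branch v) → Fin (count t) → Subset n
    decode {v} (leaf _)           _ = ⁅ v ⁆
    decode {v} (node _ _ _ _ s t) i =
      ⁅ v ⁆ ∪ (decode? s (left s t i) ∪ decode? t (right s t i))

    decode? : ∀ {v} (t : Branch v) → Fin (suc (count t)) → Subset n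
    decode? t zero    = ⊥
    decode? t (suc i) = decode t i

  root∈decode : ∀ {v} (t : Branch v) i → v ∈ decode t i
  root∈decode (leaf _)           i = x∈⁅x⁆ _
  root∈decode (node _ _ _ _ s t) i = p⊆p∪q _ (x∈⁅x⁆ _)

  decode-node⁻ : ∀ {v x : Fin n} {P Q} → x ∈ ⁅ v ⁆ ∪ (P ∪ Q) → x ≡ v ⊎ (x ∈ P ⊎ x ∈ Q)
  decode-node⁻ {v} {P = P} {Q} x∈ with x∈p∪q⁻ ⁅ v ⁆ (P ∪ Q) x∈
  ... | inj₁ x∈v = inj₁ (x∈⁅y⁆⇒x≡y v x∈v)
  ... | inj₂ x∈PQ = inj₂ (x∈p∪q⁻ P Q x∈PQ)

  decode-node⁺ : ∀ {v x : Fin n} P Q → x ∈ P ⊎ x ∈ Q → x ∈ ⁅ v ⁆ ∪ (P ∪ Q)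
  decode-node⁺ P Q x∈ = x∈p∪q⁺ (inj₂ (x∈p∪q⁺ x∈))

  mutual
    decode-descendants : ∀ {v x} (t : Branch v) i → x ∈ decode t i → Star Child v x
    decode-descendants {v} (leaf _) i x∈ with x∈⁅y⁆⇒x≡y v x∈
    ... | refl = ε
    decode-descendants (node _ va vb _ s t) i x∈ with decode-node⁻ x∈
    ... | inj₁ refl        = ε
    ... | inj₂ (inj₁ x∈s) = va ◅ decode?-descendants s (left s t i) x∈s
    ... | inj₂ (inj₂ x∈t) = vb ◅ decode?-descendants t (right s t i) x∈t

    decode?-descendants : ∀ {v x} (t : Branch v) i → x ∈ decode? t i → Star Child v x
    decode?-descendants t zero    x∈ = contradiction x∈ ∉⊥
    decode?-descendants t (suc i) x∈ = decode-descendants t i x∈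

  mutual
    -- The escape `x ≡ v` allows for the parent of the branch's own root, which lies outside the
    -- branch. One level up that parent is the node itself, supplied by `root∈decode`; at `r` there
    -- is no parent.
    decode-closed : ∀ {v x y} (t : Branch v) i → Child y x → x ∈ decode t i → x ≡ v ⊎ y ∈ decode t i
    decode-closed {v} (leaf _) i c x∈ = inj₁ (x∈⁅y⁆⇒x≡y v x∈)
    decode-closed u@(node _ va vb _ s t) i c x∈ with decode-node⁻ x∈
    ... | inj₁ x≡v = inj₁ x≡v
    ... | inj₂ (inj₁ x∈s) with decode?-closed s (left s t i) c x∈s
    ...   | inj₂ y∈ = inj₂ (decode-node⁺ (decode? s (left s t i)) (decode? t (right s t i)) (inj₁ y∈))
    ...   | inj₁ refl with parent-unique c va
    ...     | refl = inj₂ (root∈decode u i)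
    decode-closed u@(node _ va vb _ s t) i c x∈ | inj₂ (inj₂ x∈t) with decode?-closed t (right s t i) c x∈t
    ...   | inj₂ y∈ = inj₂ (decode-node⁺ (decode? s (left s t i)) (decode? t (right s t i)) (inj₂ y∈))
    ...   | inj₁ refl with parent-unique c vb
    ...     | refl = inj₂ (root∈decode u i)

    decode?-closed : ∀ {v x y} (t : Branch v) i → Child y x → x ∈ decode? t i → x ≡ v ⊎ y ∈ decode? t i
    decode?-closed t zero    c x∈ = contradiction x∈ ∉⊥
    decode?-closed t (suc i) c x∈ = decode-closed t i c x∈

  mutual
    -- Equality of sets enters as two inclusions because these restrict to the two sub-branches: an
    -- element of one side cannot reappear in the other, as siblings share no descendant.
    decode-injective : ∀ {v} (t : Branch v) i j →
                       decode t i ⊆ decode t j → decode t j ⊆ decode t i → i ≡ j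
    decode-injective (leaf _) zero zero _ _ = refl
    decode-injective u@(node a≢b va vb _ s t) i j i⊆j j⊆i = begin
      i                                  ≡⟨ Fin.combine-remQuot {suc (count s)} _ i ⟨
      combine (left s t i) (right s t i) ≡⟨ cong₂ combine
        (decode?-injective s (left s t i) (left s t j) (left-⊆ i j i⊆j) (left-⊆ j i j⊆i))
        (decode?-injective t (right s t i) (right s t j) (right-⊆ i j i⊆j) (right-⊆ j i j⊆i)) ⟩
      combine (left s t j) (right s t j) ≡⟨ Fin.combine-remQuot {suc (count s)} _ j ⟩
      j                                  ∎
      where
      open ≡-Reasoning
      left-⊆ : ∀ i j → decode u i ⊆ decode u j → decode? s (left s t i) ⊆ decode? s (left s t j)
      left-⊆ i j i⊆j x∈
        with decode-node⁻ (i⊆j (decode-node⁺ (decode? s (left s t i)) (decode? t (right s t i)) (inj₁ x∈)))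
      ... | inj₁ x≡v = contradiction x≡v (star-irreflexive va (decode?-descendants s (left s t i) x∈))
      ... | inj₂ (inj₁ x∈′) = x∈′
      ... | inj₂ (inj₂ x∈′) = contradiction
        (siblings-disjoint va vb (decode?-descendants s (left s t i) x∈)
                                 (decode?-descendants t (right s t j) x∈′)) a≢b

      right-⊆ : ∀ i j → decode u i ⊆ decode u j → decode? t (right s t i) ⊆ decode? t (right s t j)
      right-⊆ i j i⊆j x∈
        with decode-node⁻ (i⊆j (decode-node⁺ (decode? s (left s t i)) (decode? t (right s t i)) (inj₂ x∈)))
      ... | inj₁ x≡v = contradiction x≡v (star-irreflexive vb (decode?-descendants t (right s t i) x∈))
      ... | inj₂ (inj₂ x∈′) = x∈′
      ... | inj₂ (inj₁ x∈′) = contradiction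
        (siblings-disjoint va vb (decode?-descendants s (left s t j) x∈′)
                                 (decode?-descendants t (right s t i) x∈)) a≢b

    decode?-injective : ∀ {v} (t : Branch v) i j →
                        decode? t i ⊆ decode? t j → decode? t j ⊆ decode? t i → i ≡ j
    decode?-injective t zero    zero    _   _   = refl
    decode?-injective t zero    (suc j) _   j⊆i = contradiction (j⊆i (root∈decode t j)) ∉⊥
    decode?-injective t (suc i) zero    i⊆j _   = contradiction (i⊆j (root∈decode t i)) ∉⊥
    decode?-injective t (suc i) (suc j) i⊆j j⊆i = cong suc (decode-injective t i j i⊆j j⊆i)

  module _ (t : Branch r) where

    private
      subtrees = subtreesContaining G r

    -- The code sees only the vertex set, but that set determines `F`; equal codes thus identify
    -- whole entries of a list without repetitions.
    numSubtrees≤count : numSubtreesContaining G r ≤ count t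
    numSubtrees≤count = Fin.injective⇒≤ {f = λ i → code t (V i)} λ {i} {j} eq →
      lookup-injective unique i j
        (let V≡ = code-injective t (closed i) (closed j) (r∈ i) (r∈ j) eq in
         cong₂ _,_ V≡ (trans (F≡ i) (trans (cong induced V≡) (sym (F≡ j)))))
      where
      V : Fin (length subtrees) → Subset n
      V i = proj₁ (List.lookup subtrees i)

      F : Fin (length subtrees) → EdgeSet n
      F i = proj₂ (List.lookup subtrees i)

      unique : Unique subtrees
      unique = Unique.filter⁺ _ (Unique.cartesianProduct⁺ (allSubsets-unique n)
                                                           (allVecs-unique (allSubsets-unique n) n))

      entry : ∀ i → IsSubtree G (V i , F i) × r ∈ V i
      entry i = proj₂ (∈-filter⁻ (λ (V , F) → isSubtree? G (V , F) ×-dec (r ∈? V))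
                         {xs = List.cartesianProduct (allSubsets n) (allEdgeSets n)}
                         (∈-lookup {xs = subtrees} i))

      r∈ : ∀ i → r ∈ V i
      r∈ i = proj₂ (entry i)

      closed : ∀ i → Closed (V i)
      closed i = subtree⇒closed (V i) (F i) (proj₁ (entry i)) (r∈ i)

      F≡ : ∀ i → F i ≡ induced (V i)
      F≡ i = subtree⇒induced (V i) (F i) (proj₁ (entry i)) (r∈ i)

    count≤numSubtrees : count t ≤ numSubtreesContaining G r
    count≤numSubtrees = injection⇒length≤ subtrees (λ i → decode t i , induced (decode t i)) mem
      λ {i} {j} eq →
      decode-injective t i j (⊆-reflexive (cong proj₁ eq)) (⊆-reflexive (sym (cong proj₁ eq)))
      where
      closed : ∀ i → Closed (decode t i)
      closed i c v∈ with decode-closed t i c v∈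
      ... | inj₁ refl = contradiction c root-orphan
      ... | inj₂ u∈   = u∈

      mem : ∀ i → (decode t i , induced (decode t i)) ∈ₗ subtrees
      mem i = ∈-filter⁺ (λ (V , F) → isSubtree? G (V , F) ×-dec (r ∈? V))
        (∈-cartesianProduct⁺ (∈-allSubsets _) (∈-allVecs ∈-allSubsets _))
        (closed⇒subtree (closed i) (root∈decode t i) , root∈decode t i)

  -- Bounds in terms of internal vertices

  count-lower : ∀ {v} (t : Branch v) → 3 * 2 ^ internals t ≤ count t + 2
  count-lower (leaf _) = ℕ.≤-refl
  count-lower (node _ _ _ _ s t) = subst (λ x → 3 * (2 * x) ≤ suc (count s) * suc (count t) + 2)
    (sym (ℕ.^-distribˡ-+-* 2 (internals s) (internals t)))
    (product-bound (ℕ.m^n>0 2 (internals s)) (ℕ.m^n>0 2 (internals t)) (count-lower s) (count-lower t))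

  AtMostTwoPerRank : Set
  AtMostTwoPerRank = ∀ {x y z} → rank x ≡ rank y → rank y ≡ rank z → x ≢ y → y ≢ z → ¬ x ≢ z

  count-caterpillar : AtMostTwoPerRank → ∀ {v} (t : Branch v) → count t + 2 ≡ 3 * 2 ^ internals t
  count-caterpillar h (leaf _) = refl
  count-caterpillar h (node _ _ _ _ (leaf _) t) = double (count t) (internals t) (count-caterpillar h t)
  count-caterpillar h (node _ _ _ _ s@(node _ _ _ _ _ _) (leaf _)) = begin
    suc (count s) * 2 + 2          ≡⟨ cong (_+ 2) (ℕ.*-comm (suc (count s)) 2) ⟩
    2 * suc (count s) + 2          ≡⟨ double (count s) (internals s) (count-caterpillar h s) ⟩
    3 * 2 ^ suc (internals s)      ≡⟨ cong (λ i → 3 * 2 ^ suc i) (ℕ.+-identityʳ (internals s)) ⟨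
    3 * 2 ^ suc (internals s + 0)  ∎
    where open ≡-Reasoning
  -- With both siblings internal, two children of the first and one of the second are three vertices
  -- of equal rank, distinct because siblings share no child.
  count-caterpillar h (node a≢b va vb _ (node a₁≢a₂ aa₁ aa₂ _ _ _) (node _ bb₁ _ _ _ _)) = contradiction
    (apart aa₁) (h (trans (proj₂ aa₁) (sym (proj₂ aa₂)))
                   (trans (proj₂ aa₂) (trans (cong suc (trans (proj₂ va) (sym (proj₂ vb)))) (sym (proj₂ bb₁))))
                   a₁≢a₂ (apart aa₂))
    where
    apart : ∀ {x} → Child _ x → x ≢ _
    apart ax refl = a≢b (siblings-disjoint va vb (ax ◅ ε) (bb₁ ◅ ε))

  -- The recursion runs on fuel `k`: each step down trades one unit of fuel for one unit of rank,
  -- and with no fuel left the rank would exceed its bound.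
  grow : (∀ v → Childless v ⊎ TwoChildren v) → ∀ v → Branch v
  grow split v = go (suc (proj₁ (bounded rank))) v (s≤s (ℕ.m≤m+n _ _))
    where
    go : ∀ k v → proj₁ (bounded rank) < k + rank v → Branch v
    go zero    v b< = contradiction (proj₂ (bounded rank) v) (ℕ.<⇒≱ b<)
    go (suc k) v b< with split v
    ... | inj₁ childless = leaf childless
    ... | inj₂ (a , b , a≢b , va , vb , only) =
      node a≢b va vb only (go k a (deeper va)) (go k b (deeper vb))
      where
      deeper : ∀ {c} → Child v c → proj₁ (bounded rank) < k + rank c
      deeper (_ , rc) =
        ℕ.≤-trans b< (ℕ.≤-reflexive (trans (sym (ℕ.+-suc k (rank v))) (cong (k +_) (sym rc))))

-- Bounds for rooted binary trees

module _ (T : RootedBinaryTree n) where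

  private
    G = graph T
    r = root T
    R = TreeRanking.ranking G r (isTree T)

  open Ranked R

  -- Away from the root exactly one neighbour, the parent, is not a child, so degrees 1 and 3 leave
  -- none and two. For `n ≡ 1` there is no second vertex to be a child.
  children : ∀ v → Childless v ⊎ TwoChildren v
  children v with degrees T
  ... | inj₁ refl = inj₁ λ c → child⇒≢ c (trans (only v) (sym (only _)))
    where
    only : (x : Fin 1) → x ≡ zero
    only zero = refl
  ... | inj₂ (root-degree , other-degrees) with v Fin.≟ r
  ...   | yes refl with ∣p∣≡2⇒pair root-degree
  ...     | a , b , a≢b , a∈ , b∈ , only = inj₂ (a , b , a≢b , child a∈ , child b∈ , only ∘ proj₁)
    where
    child : ∀ {c} → Adj (edges G) r c → Child r c
    child e with adj⇒child e
    ... | inj₁ c = c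
    ... | inj₂ c = contradiction c root-orphan
  children v | inj₂ (_ , other-degrees) | no v≢r with parent v v≢r
  ... | p , pv = [ inj₁ ∘ no-children , inj₂ ∘ two-children ]′ (other-degrees v v≢r)
    where
    S = Vec.lookup (edges G) v

    p∈S : p ∈ S
    p∈S = symmetric G (proj₁ pv)

    child⇒∈ : ∀ {c} → Child v c → c ∈ S - p
    child⇒∈ vc = x∈p∧x≢y⇒x∈p-y (proj₁ vc) λ { refl → ℕ.<-asym (child⇒rank< vc) (child⇒rank< pv) }

    ∈⇒child : ∀ {c} → c ∈ S - p → Child v c
    ∈⇒child c∈ with adj⇒child (p─q⊆p S ⁅ p ⁆ c∈)
    ... | inj₁ vc = vc
    ... | inj₂ cv = contradiction (parent-unique cv pv) (x∈p-y⇒x≢y {S = S} c∈)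

    no-children : ∣ S ∣ ≡ 1 → Childless v
    no-children ∣S∣≡1 vc = ∣p∣≡0⇒∉ (ℕ.suc-injective (trans (sym (∣p∣≡1+∣p-x∣ p∈S)) ∣S∣≡1)) (child⇒∈ vc)

    two-children : ∣ S ∣ ≡ 3 → TwoChildren v
    two-children ∣S∣≡3 with ∣p∣≡2⇒pair (ℕ.suc-injective (trans (sym (∣p∣≡1+∣p-x∣ p∈S)) ∣S∣≡3))
    ... | a , b , a≢b , a∈ , b∈ , only = a , b , a≢b , ∈⇒child a∈ , ∈⇒child b∈ , only ∘ child⇒∈

  private
    t : Branch r
    t = grow children r

  rootBranchInternals : ℕ
  rootBranchInternals = internals t

  n≡1+2*internals : n ≡ suc (rootBranchInternals * 2)
  n≡1+2*internals = size t

  numRootSubtrees-lower : 3 * 2 ^ rootBranchInternals ≤ numRootSubtrees T + 2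
  numRootSubtrees-lower = ℕ.≤-trans (count-lower t) (ℕ.+-monoˡ-≤ 2 (count≤numSubtrees t))

  numRootSubtrees-upper : TwoPerLevel T → numRootSubtrees T + 2 ≤ 3 * 2 ^ rootBranchInternals
  numRootSubtrees-upper two = ℕ.≤-trans (ℕ.+-monoˡ-≤ 2 (numSubtrees≤count t))
    (ℕ.≤-reflexive (count-caterpillar atMostTwo t))
    where
    atMostTwo : AtMostTwoPerRank
    atMostTwo {x} {y} {z} x~y y~z x≢y y≢z x≢z with rank x in rx
    -- `TwoPerLevel` does not speak of level zero; only the root has rank zero.
    ... | zero = x≢y (trans (at-root x rx) (sym (at-root y (sym x~y))))
      where
      at-root : ∀ v → rank v ≡ 0 → v ≡ r
      at-root v rv with v Fin.≟ r
      ... | yes v≡r = v≡r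
      ... | no v≢r with parent v v≢r
      ...   | _ , _ , rv′ = contradiction (trans (sym rv) rv′) λ ()
    ... | suc k with two (suc k) (s≤s z≤n) (x , Equivalence.from isDistance⇔rank rx)
    ...   | S , ∣S∣≡2 , S⇔ with ∣p∣≡2⇒pair ∣S∣≡2
    ...     | a , b , _ , _ , _ , only
      with only (at-level x rx) | only (at-level y (sym x~y)) | only (at-level z (sym (trans x~y y~z)))
      where
      at-level : ∀ v → rank v ≡ suc k → v ∈ S
      at-level v rv = Equivalence.from (S⇔ v) (Equivalence.from isDistance⇔rank rv)
    ...       | inj₁ refl | inj₁ refl | _         = x≢y refl
    ...       | inj₁ refl | _         | inj₁ refl = x≢z refl
    ...       | _         | inj₁ refl | inj₁ refl = y≢z refl
    ...       | inj₂ refl | inj₂ refl | _         = x≢y refl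
    ...       | inj₂ refl | _         | inj₂ refl = x≢z refl
    ...       | _         | inj₂ refl | inj₂ refl = y≢z refl

-- Existence of a tree with two vertices per level

-- The caterpillar with m levels below the root 0.  The vertices 0 and 1 of
-- caterpillar (suc m) are a new root and a new leaf; vertex 2 + v is vertex v
-- of caterpillar m.
caterpillarRow : ∀ m → Fin (suc (m * 2)) → Subset (suc (m * 2))
caterpillarRow zero    _                   = ⊥
caterpillarRow (suc m) zero                = outside ∷ inside ∷ ⁅ zero ⁆
caterpillarRow (suc m) (suc zero)          = inside ∷ ⊥
caterpillarRow (suc m) (suc (suc zero))    = inside ∷ outside ∷ caterpillarRow m zero
caterpillarRow (suc m) (suc (suc (suc v))) = outside ∷ outside ∷ caterpillarRow m (suc v)

caterpillarRank : ∀ m → Fin (suc (m * 2)) → ℕ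
caterpillarRank zero    _             = 0
caterpillarRank (suc m) zero          = 0
caterpillarRank (suc m) (suc zero)    = 1
caterpillarRank (suc m) (suc (suc v)) = suc (caterpillarRank m v)

caterpillarRank-root : ∀ m → caterpillarRank m zero ≡ 0
caterpillarRank-root zero    = refl
caterpillarRank-root (suc m) = refl

-- The parent relation in inductive form: uniqueness of parents and the growth of the rank become
-- case analysis, detached from the adjacency matrix.
data CaterpillarChild : ∀ m → Fin (suc (m * 2)) → Fin (suc (m * 2)) → Set where
  new-leaf : ∀ {m} → CaterpillarChild (suc m) zero (suc zero)
  old-root : ∀ {m} → CaterpillarChild (suc m) zero (suc (suc zero))
  old      : ∀ {m u v} → CaterpillarChild m u v → CaterpillarChild (suc m) (suc (suc u)) (suc (suc v))

row⇒child : ∀ m u v → v ∈ caterpillarRow m u → CaterpillarChild m u v ⊎ CaterpillarChild m v u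
row⇒child zero    _    v             v∈ = contradiction v∈ ∉⊥
row⇒child (suc m) zero (suc zero)    _  = inj₁ new-leaf
row⇒child (suc m) zero (suc (suc v)) (there (there v∈)) with x∈⁅y⁆⇒x≡y zero v∈
... | refl = inj₁ old-root
row⇒child (suc m) (suc zero)          zero          _          = inj₂ new-leaf
row⇒child (suc m) (suc zero)          (suc v)       (there v∈) = contradiction v∈ ∉⊥
row⇒child (suc m) (suc (suc zero))    zero          _          = inj₂ old-root
row⇒child (suc m) (suc (suc zero))    (suc (suc v)) (there (there v∈)) =
  [ inj₁ ∘ old , inj₂ ∘ old ]′ (row⇒child m zero v v∈)
row⇒child (suc m) (suc (suc (suc u))) (suc (suc v)) (there (there v∈)) =
  [ inj₁ ∘ old , inj₂ ∘ old ]′ (row⇒child m (suc u) v v∈)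

child⇒row : ∀ {m u v} → CaterpillarChild m u v → v ∈ caterpillarRow m u × u ∈ caterpillarRow m v
child⇒row new-leaf = there here , here
child⇒row old-root = there (there here) , here
child⇒row {suc m} (old {u = u} {v} c) = shift u (proj₁ (child⇒row c)) , shift v (proj₂ (child⇒row c))
  where
  shift : ∀ {v} u → v ∈ caterpillarRow m u → suc (suc v) ∈ caterpillarRow (suc m) (suc (suc u))
  shift zero    v∈ = there (there v∈)
  shift (suc u) v∈ = there (there v∈)

child⇒caterpillarRank : ∀ {m u v} → CaterpillarChild m u v → caterpillarRank m v ≡ suc (caterpillarRank m u)
child⇒caterpillarRank         new-leaf = refl
child⇒caterpillarRank {suc m} old-root = cong suc (caterpillarRank-root m)
child⇒caterpillarRank         (old c)  = cong suc (child⇒caterpillarRank c)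

caterpillarParent : ∀ m v → v ≢ zero → ∃[ u ] CaterpillarChild m u v
caterpillarParent zero    zero                v≢ = contradiction refl v≢
caterpillarParent (suc m) zero                v≢ = contradiction refl v≢
caterpillarParent (suc m) (suc zero)          _  = _ , new-leaf
caterpillarParent (suc m) (suc (suc zero))    _  = _ , old-root
caterpillarParent (suc m) (suc (suc (suc v))) _  with caterpillarParent m (suc v) (λ ())
... | u , c = _ , old c

root-not-child : ∀ {m u} → ¬ CaterpillarChild m u zero
root-not-child {zero}  ()
root-not-child {suc m} ()

caterpillarParent-unique : ∀ {m u u′ v} → CaterpillarChild m u v → CaterpillarChild m u′ v → u ≡ u′
caterpillarParent-unique new-leaf new-leaf = refl
caterpillarParent-unique old-root old-root = refl
caterpillarParent-unique old-root (old c)  = contradiction c root-not-child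
caterpillarParent-unique (old c)  old-root = contradiction c root-not-child
caterpillarParent-unique (old c)  (old c′) = cong (λ u → suc (suc u)) (caterpillarParent-unique c c′)

caterpillarEdges : ∀ m → EdgeSet (suc (m * 2))
caterpillarEdges m = Vec.tabulate (caterpillarRow m)

module _ (m : ℕ) where

  private
    adj⁻ : ∀ {u v} → Adj (caterpillarEdges m) u v → CaterpillarChild m u v ⊎ CaterpillarChild m v u
    adj⁻ {u} {v} e = row⇒child m u v (subst (v ∈_) (lookup∘tabulate (caterpillarRow m) u) e)

    adj⁺ : ∀ {u v} → v ∈ caterpillarRow m u → Adj (caterpillarEdges m) u v
    adj⁺ {u} {v} = subst (v ∈_) (sym (lookup∘tabulate (caterpillarRow m) u))

  caterpillarGraph : Graph (suc (m * 2))
  caterpillarGraph = record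
    { edges       = caterpillarEdges m
    ; symmetric   = [ adj⁺ ∘ proj₂ ∘ child⇒row , adj⁺ ∘ proj₁ ∘ child⇒row ]′ ∘ adj⁻
    ; irreflexive = λ v → [ loopless , loopless ]′ ∘ adj⁻
    }
    where
    loopless : ∀ {v} → ¬ CaterpillarChild m v v
    loopless c = ℕ.1+n≢n (sym (child⇒caterpillarRank c))

  caterpillarRanking : Ranking caterpillarGraph zero
  caterpillarRanking = record
    { rank          = caterpillarRank m
    ; rank-root     = caterpillarRank-root m
    ; adj⇒child     = [ inj₁ ∘ ranked , inj₂ ∘ ranked ]′ ∘ adj⁻
    ; parent        = λ v v≢ → _ , ranked (proj₂ (caterpillarParent m v v≢))
    ; parent-unique = λ c c′ → caterpillarParent-unique (unranked c) (unranked c′)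
    }
    where
    RankedChild : Fin (suc (m * 2)) → Fin (suc (m * 2)) → Set
    RankedChild u v = Adj (caterpillarEdges m) u v × caterpillarRank m v ≡ suc (caterpillarRank m u)

    ranked : ∀ {u v} → CaterpillarChild m u v → RankedChild u v
    ranked c = adj⁺ (proj₁ (child⇒row c)) , child⇒caterpillarRank c

    unranked : ∀ {u v} → RankedChild u v → CaterpillarChild m u v
    unranked (e , rv) with adj⁻ e
    ... | inj₁ c = c
    -- The opposite orientation would give the rank of `u` as two more than itself.
    ... | inj₂ c = contradiction (trans (child⇒caterpillarRank c) (cong suc rv)) (ℕ.m≢1+n+m _ {1})

∣caterpillarRow∣-root : ∀ m → ∣ caterpillarRow (suc m) zero ∣ ≡ 2
∣caterpillarRow∣-root m = cong suc (∣⁅x⁆∣≡1 {suc (m * 2)} zero)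

∣caterpillarRow∣ : ∀ m v → v ≢ zero → ∣ caterpillarRow m v ∣ ≡ 1 ⊎ ∣ caterpillarRow m v ∣ ≡ 3
∣caterpillarRow∣ zero    zero                   v≢ = contradiction refl v≢
∣caterpillarRow∣ (suc m) zero                   v≢ = contradiction refl v≢
∣caterpillarRow∣ (suc m) (suc zero)             _  = inj₁ (cong suc (∣⊥∣≡0 (suc (suc (m * 2)))))
-- The old root gains the new root as a neighbour: 0 + 1 if it was the only vertex, 2 + 1 otherwise.
∣caterpillarRow∣ (suc zero) (suc (suc zero))    _  = inj₁ refl
∣caterpillarRow∣ (suc (suc m)) (suc (suc zero)) _  = inj₂ (cong suc (∣caterpillarRow∣-root m))
∣caterpillarRow∣ (suc m) (suc (suc (suc v)))    _  = ∣caterpillarRow∣ m (suc v) λ ()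

caterpillarLevel : ∀ m → ℕ → Subset (suc (m * 2))
caterpillarLevel zero    zero          = inside ∷ []
caterpillarLevel zero    (suc k)       = outside ∷ []
caterpillarLevel (suc m) zero          = inside ∷ ⊥
caterpillarLevel (suc m) (suc zero)    = outside ∷ inside ∷ caterpillarLevel m zero
caterpillarLevel (suc m) (suc (suc k)) = outside ∷ outside ∷ caterpillarLevel m (suc k)

caterpillarLevel⁻ : ∀ m k v → v ∈ caterpillarLevel m k → caterpillarRank m v ≡ k
caterpillarLevel⁻ zero    zero          zero          _ = refl
caterpillarLevel⁻ (suc m) zero          zero          _ = refl
caterpillarLevel⁻ (suc m) zero          (suc v)       (there v∈) = contradiction v∈ ∉⊥
caterpillarLevel⁻ (suc m) (suc zero)    (suc zero)    _ = refl
caterpillarLevel⁻ (suc m) (suc zero)    (suc (suc v)) (there (there v∈)) =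
  cong suc (caterpillarLevel⁻ m zero v v∈)
caterpillarLevel⁻ (suc m) (suc (suc k)) (suc (suc v)) (there (there v∈)) =
  cong suc (caterpillarLevel⁻ m (suc k) v v∈)

caterpillarLevel⁺ : ∀ m k v → caterpillarRank m v ≡ k → v ∈ caterpillarLevel m k
caterpillarLevel⁺ zero    zero          zero          _  = here
caterpillarLevel⁺ (suc m) zero          zero          _  = here
caterpillarLevel⁺ (suc m) zero          (suc zero)    ()
caterpillarLevel⁺ (suc m) zero          (suc (suc v)) ()
caterpillarLevel⁺ (suc m) (suc zero)    (suc zero)    _  = there here
caterpillarLevel⁺ (suc m) (suc zero)    (suc (suc v)) eq =
  there (there (caterpillarLevel⁺ m zero v (ℕ.suc-injective eq)))
caterpillarLevel⁺ (suc m) (suc (suc k)) (suc (suc v)) eq =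
  there (there (caterpillarLevel⁺ m (suc k) v (ℕ.suc-injective eq)))

-- The vertex `v` certifies that the level occurs; beyond depth `m` levels are empty.
∣caterpillarLevel∣ : ∀ m k v → caterpillarRank m v ≡ suc k → ∣ caterpillarLevel m (suc k) ∣ ≡ 2
∣caterpillarLevel∣ (suc zero)    zero    _             _  = refl
∣caterpillarLevel∣ (suc (suc m)) zero    _             _  = cong (2 +_) (∣⊥∣≡0 (m * 2))
∣caterpillarLevel∣ (suc m)       (suc k) (suc (suc v)) eq = ∣caterpillarLevel∣ m k v (ℕ.suc-injective eq)

caterpillar : ∀ m → RootedBinaryTree (suc (m * 2))
caterpillar m = record
  { graph   = caterpillarGraph m
  ; isTree  = Ranked.ranked⇒tree (caterpillarRanking m)
  ; root    = zero
  ; degrees = row-sizes m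
  }
  where
  row≡ : ∀ m v → Vec.lookup (caterpillarEdges m) v ≡ caterpillarRow m v
  row≡ m = lookup∘tabulate (caterpillarRow m)

  row-sizes : ∀ m → suc (m * 2) ≡ 1 ⊎
            (degree (caterpillarGraph m) zero ≡ 2 ×
             (∀ v → v ≢ zero → degree (caterpillarGraph m) v ≡ 1 ⊎ degree (caterpillarGraph m) v ≡ 3))
  row-sizes zero    = inj₁ refl
  row-sizes (suc m) = inj₂ (trans (cong ∣_∣ (row≡ (suc m) zero)) (∣caterpillarRow∣-root m) , λ v v≢ →
    subst (λ S → ∣ S ∣ ≡ 1 ⊎ ∣ S ∣ ≡ 3) (sym (row≡ (suc m) v)) (∣caterpillarRow∣ (suc m) v v≢))

caterpillar-twoPerLevel : ∀ m → TwoPerLevel (caterpillar m)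
caterpillar-twoPerLevel m (suc k) _ (v , v-level) =
  caterpillarLevel m (suc k) ,
  ∣caterpillarLevel∣ m k v (to v-level) ,
  λ w → mk⇔ (from ∘ caterpillarLevel⁻ m (suc k) w) (caterpillarLevel⁺ m (suc k) w ∘ to)
  where
  to : ∀ {w} → HasLevel (caterpillar m) (suc k) w → caterpillarRank m w ≡ suc k
  to = Equivalence.to (Ranked.isDistance⇔rank (caterpillarRanking m))

  from : ∀ {w} → caterpillarRank m w ≡ suc k → HasLevel (caterpillar m) (suc k) w
  from = Equivalence.from (Ranked.isDistance⇔rank (caterpillarRanking m))

proposition2p13 : ∀ (n : ℕ) → n % 2 ≡ 1 →
    (∃[ T₀ ] TwoPerLevel {n} T₀) ×
    (∀ (T₀ : RootedBinaryTree n) → TwoPerLevel T₀ →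
    ∀ (T : RootedBinaryTree n) → numRootSubtrees T ≥ numRootSubtrees T₀)
proposition2p13 n n-odd = exists , minimal
  where
  exists : ∃[ T₀ ] TwoPerLevel {n} T₀
  -- For odd `n` division gives n = 1 + 2 (n / 2), so `n / 2` levels below the root are required.
  exists = subst (λ n → ∃[ T₀ ] TwoPerLevel {n} T₀)
    (sym (trans (m≡m%n+[m/n]*n n 2) (cong (_+ n / 2 * 2) n-odd)))
    (caterpillar (n / 2) , caterpillar-twoPerLevel (n / 2))

  minimal : ∀ (T₀ : RootedBinaryTree n) → TwoPerLevel T₀ →
            ∀ (T : RootedBinaryTree n) → numRootSubtrees T ≥ numRootSubtrees T₀
  minimal T₀ two T = ℕ.+-cancelʳ-≤ 2 _ _ (begin
    numRootSubtrees T₀ + 2           ≤⟨ numRootSubtrees-upper T₀ two ⟩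
    3 * 2 ^ rootBranchInternals T₀  ≡⟨ cong (λ i → 3 * 2 ^ i) same-internals ⟩
    3 * 2 ^ rootBranchInternals T   ≤⟨ numRootSubtrees-lower T ⟩
    numRootSubtrees T + 2            ∎)
    where
    open ℕ.≤-Reasoning
    same-internals : rootBranchInternals T₀ ≡ rootBranchInternals T
    same-internals =
      ℕ.*-cancelʳ-≡ _ _ 2 (ℕ.suc-injective (trans (sym (n≡1+2*internals T₀)) (n≡1+2*internals T)))
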